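{- Let $\{a_n\}_{n\geq 0}$ be the Narayana sequence, defined by $a_0=0$, $a_1=a_2=1$ and $a_n=a_{n-1}+a_{n-3}$ for $n\geq 3$. The only solutions of the equation $a_n=m!$ in positive integers $n$ and $m$ are $(n,m)\in\{(1,1),(2,1),(3,1),(4,2),(7,3)\}$. -}

module Defs where

open import Data.Nat.Base using (ℕ; zero; suc; _+_)

narayana : ℕ → ℕ
narayana zero = 0
narayana (suc zero) = 1
narayana (suc (suc zero)) = 1
narayana (suc (suc (suc n))) = narayana (suc (suc n)) + narayana n

{-# OPTIONS --safe #-}

-- Extended to negative indices, the sequence vanishes at 0, -1, -3 and -8, and these are all of
-- its 3-adic zeros. Writing x for the index shift, x³ = x² + 1 gives
-- x^(24·3^j) = 1 + 3^(j+2) v with v ≡ v₀ (mod 9) for a fixed v₀, so by Hensel lifting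
-- 3^(j+3) ∣ a_n forces n ≡ 0, -1, -3 or -8 (mod 24·3^j), hence n + 8 ≥ 24·3^j when n ≥ 1.
-- If a_n = m!, then 3^⌊m/3⌋ ∣ a_n makes n exponential in m, and a_n, being exponential in n,
-- exceeds m! as soon as m ≥ 15; finitely many pairs remain.
module Submission where

open import Defs
open import Data.Fin.Base as Fin using (Fin; toℕ)
import Data.Fin.Properties as Fin
open import Data.Integer.Base using (ℤ; +_; -[1+_]; _+_; _*_; _^_; _-_; NonZero)
open import Data.Integer.Divisibility.Signed
  using (_∣_; divides; _∣?_; ∣m+n∣m⇒∣n; ∣m⇒∣m*n; *-cancelˡ-∣; ∣ᵤ⇒∣; ∣⇒∣ᵤ)
import Data.Integer.Properties as ℤ
open import Data.Integer.Tactic.RingSolver using (solve-∀)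
open import Data.Nat.Base as ℕ using (ℕ; zero; suc; _!; _≤_; _<_; z≤n; s≤s)
import Data.Nat.Divisibility as ℕ
import Data.Nat.DivMod as ℕ
import Data.Nat.Properties as ℕ
import Data.Nat.Tactic.RingSolver as ℕ-Solver
open import Data.Product using (Σ; ∃; _×_; _,_; proj₁; proj₂)
open import Data.Sum using (_⊎_; inj₁; inj₂)
open import Function.Bundles using (_⇔_; mk⇔)
open import Relation.Binary.PropositionalEquality
  using (_≡_; refl; sym; trans; cong; cong₂; subst; subst₂; module ≡-Reasoning)
open import Relation.Nullary.Decidable using (Dec; _→-dec_; _⊎-dec_; _×-dec_; toWitness)
open import Relation.Nullary.Negation using (¬_; contradiction)

-- The sequence extended to negative indices.

-- shifted n is a_{n-8} for the two-sided extension of the sequence.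
shifted : ℕ → ℤ
shifted 0 = + 0
shifted 1 = -[1+ 1 ]
shifted 2 = + 1
shifted 3 = + 1
shifted 4 = -[1+ 0 ]
shifted 5 = + 0
shifted 6 = + 1
shifted 7 = + 0
shifted (suc (suc (suc (suc (suc (suc (suc (suc n)))))))) = + narayana n

Recurrent : (ℕ → ℤ) → Set
Recurrent f = ∀ n → f (3 ℕ.+ n) ≡ f (2 ℕ.+ n) + f n

shifted-recurrent : Recurrent shifted
shifted-recurrent 0 = refl
shifted-recurrent 1 = refl
shifted-recurrent 2 = refl
shifted-recurrent 3 = refl
shifted-recurrent 4 = refl
shifted-recurrent 5 = refl
shifted-recurrent 6 = refl
shifted-recurrent 7 = refl
shifted-recurrent (suc (suc (suc (suc (suc (suc (suc (suc n)))))))) = refl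

-- A sliding window of three terms. It evaluates with one addition per step, whereas the branching
-- recursion of `narayana` is exponential, so the finite checks by computation use this form.
iterateRec : ℕ → ℤ → ℤ → ℤ → ℤ
iterateRec zero    x y z = x
iterateRec (suc n) x y z = iterateRec n y z (z + x)

recurrent-iterate : ∀ f → Recurrent f → ∀ n → f n ≡ iterateRec n (f 0) (f 1) (f 2)
recurrent-iterate f rec zero    = refl
recurrent-iterate f rec (suc n) =
  trans (recurrent-iterate (λ k → f (suc k)) (λ k → rec (suc k)) n)
        (cong (iterateRec n (f 1) (f 2)) (rec 0))

recurrent-unique : ∀ f g → Recurrent f → Recurrent g →
  f 0 ≡ g 0 → f 1 ≡ g 1 → f 2 ≡ g 2 → ∀ n → f n ≡ g n
recurrent-unique f g recf recg e₀ e₁ e₂ n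
  rewrite recurrent-iterate f recf n | recurrent-iterate g recg n | e₀ | e₁ | e₂ = refl

-- Polynomials in the shift, modulo x³ - x² - 1.

-- (p , q , r) stands for p x² + q x + r, with x acting as the index shift.
Poly : Set
Poly = ℤ × ℤ × ℤ

act : Poly → (ℕ → ℤ) → ℕ → ℤ
act (p , q , r) f n = p * f (2 ℕ.+ n) + q * f (1 ℕ.+ n) + r * f n

infixl 6 _⊕_
infixl 7 _⊗_ _·_

_⊕_ : Poly → Poly → Poly
(p , q , r) ⊕ (p′ , q′ , r′) = p + p′ , q + q′ , r + r′

_·_ : ℤ → Poly → Poly
k · (p , q , r) = k * p , k * q , k * r

-- Reduced by x³ = x² + 1 and x⁴ = x² + x + 1.
_⊗_ : Poly → Poly → Poly
(p , q , r) ⊗ (p′ , q′ , r′) =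
    p * p′ + (p * q′ + q * p′) + (p * r′ + q * q′ + r * p′)
  , p * p′ + (q * r′ + r * q′)
  , p * p′ + (p * q′ + q * p′) + r * r′

act-⊕ : ∀ u w f n → act (u ⊕ w) f n ≡ act u f n + act w f n
act-⊕ (p , q , r) (p′ , q′ , r′) f n = lemma p q r p′ q′ r′ (f (2 ℕ.+ n)) (f (1 ℕ.+ n)) (f n)
  where
  lemma : ∀ p q r p′ q′ r′ z y x →
    (p + p′) * z + (q + q′) * y + (r + r′) * x ≡ (p * z + q * y + r * x) + (p′ * z + q′ * y + r′ * x)
  lemma = solve-∀

act-· : ∀ k u f n → act (k · u) f n ≡ k * act u f n
act-· k (p , q , r) f n = lemma k p q r (f (2 ℕ.+ n)) (f (1 ℕ.+ n)) (f n)
  where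
  lemma : ∀ k p q r z y x → k * p * z + k * q * y + k * r * x ≡ k * (p * z + q * y + r * x)
  lemma = solve-∀

act-+* : ∀ u f g k h n → (∀ m → f m ≡ g m + k * h m) → act u f n ≡ act u g n + k * act u h n
act-+* (p , q , r) f g k h n eq
  rewrite eq n | eq (1 ℕ.+ n) | eq (2 ℕ.+ n) =
  lemma p q r k (g (2 ℕ.+ n)) (g (1 ℕ.+ n)) (g n) (h (2 ℕ.+ n)) (h (1 ℕ.+ n)) (h n)
  where
  lemma : ∀ p q r k z y x z′ y′ x′ →
    p * (z + k * z′) + q * (y + k * y′) + r * (x + k * x′) ≡
    (p * z + q * y + r * x) + k * (p * z′ + q * y′ + r * x′)
  lemma = solve-∀

-- Composing shift operators multiplies polynomials. The composite reaches `f (4 + n)`; the two uses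
-- of `rec` remove the terms of degree 4 and 3, which is the reduction built into `⊗`.
act-⊗ : ∀ u w f → Recurrent f → ∀ n → act u (act w f) n ≡ act (u ⊗ w) f n
act-⊗ (p , q , r) (p′ , q′ , r′) f rec n
  rewrite rec (1 ℕ.+ n) | rec n =
  lemma p q r p′ q′ r′ (f (2 ℕ.+ n)) (f (1 ℕ.+ n)) (f n)
  where
  lemma : ∀ p q r p′ q′ r′ z y x →
    p * (p′ * (z + x + y) + q′ * (z + x) + r′ * z) + q * (p′ * (z + x) + q′ * z + r′ * y)
      + r * (p′ * z + q′ * y + r′ * x) ≡
    (p * p′ + (p * q′ + q * p′) + (p * r′ + q * q′ + r * p′)) * z
      + (p * p′ + (q * r′ + r * q′)) * y
      + (p * p′ + (p * q′ + q * p′) + r * r′) * x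
  lemma = solve-∀

act-recurrent : ∀ u f → Recurrent f → Recurrent (act u f)
act-recurrent (p , q , r) f rec n
  rewrite rec (2 ℕ.+ n) | rec (1 ℕ.+ n) | rec n =
  lemma p q r (f (2 ℕ.+ n)) (f (1 ℕ.+ n)) (f n)
  where
  lemma : ∀ p q r z y x →
    p * (z + x + y + z) + q * (z + x + y) + r * (z + x) ≡
    (p * (z + x + y) + q * (z + x) + r * z) + (p * z + q * y + r * x)
  lemma = solve-∀

-- Shifts by multiples of 24·3^j, to 3-adic precision.

period : ℕ → ℕ
period j = 24 ℕ.* 3 ℕ.^ j

-- x²⁴ = 1 + 9 v₀ modulo x³ - x² - 1.
v₀ : Poly
v₀ = + 305 , + 142 , + 208

act-v₀+9w : ∀ w f n → act (v₀ ⊕ + 9 · w) f n ≡ act v₀ f n + + 9 * act w f n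
act-v₀+9w w f n = trans (act-⊕ v₀ (+ 9 · w) f n) (cong (λ t → act v₀ f n + t) (act-· (+ 9) w f n))

-- Both sides satisfy the recurrence, so agreement at 0, 1 and 2, found by evaluation, is enough.
shift-24 : ∀ n → shifted (n ℕ.+ 24) ≡ shifted n + + 9 * act v₀ shifted n
shift-24 = recurrent-unique _ _ (λ n → shifted-recurrent (n ℕ.+ 24)) rhs-recurrent refl refl refl
  where
  lemma : ∀ x y k z w → (x + y) + k * (z + w) ≡ (x + k * z) + (y + k * w)
  lemma = solve-∀
  rhs-recurrent : Recurrent (λ n → shifted n + + 9 * act v₀ shifted n)
  rhs-recurrent n = trans
    (cong₂ (λ s t → s + + 9 * t) (shifted-recurrent n) (act-recurrent v₀ shifted shifted-recurrent n))
    (lemma (shifted (2 ℕ.+ n)) (shifted n) (+ 9) (act v₀ shifted (2 ℕ.+ n)) (act v₀ shifted n))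

-- Encodes x^N = 1 + c v as an identity of operators on `shifted`.
ShiftBy : ℤ → Poly → ℕ → Set
ShiftBy c v N = ∀ n → shifted (n ℕ.+ N) ≡ shifted n + c * act v shifted n

-- The binomial expansion of x^(3N) = (1 + c v)³.
shift-triple : ∀ {c v N} → ShiftBy c v N → ∀ n →
  shifted (n ℕ.+ 3 ℕ.* N) ≡
    shifted n + + 3 * c * act v shifted n + + 3 * (c * c) * act (v ⊗ v) shifted n
      + c * c * c * act (v ⊗ (v ⊗ v)) shifted n
shift-triple {c} {v} {N} shift n = begin
  b (n ℕ.+ 3 ℕ.* N)                   ≡⟨ cong b (reindex n N) ⟩
  b (n ℕ.+ N ℕ.+ N ℕ.+ N)             ≡⟨ shift (n ℕ.+ N ℕ.+ N) ⟩
  b (n ℕ.+ N ℕ.+ N) + c * g (n ℕ.+ N ℕ.+ N)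
    ≡⟨ cong₂ (λ s t → s + c * t) (shift (n ℕ.+ N)) (shift-g (n ℕ.+ N)) ⟩
  b (n ℕ.+ N) + c * g (n ℕ.+ N) + c * (g (n ℕ.+ N) + c * h (n ℕ.+ N))
    ≡⟨ cong₂ (λ s t → s + c * t + c * (t + c * h (n ℕ.+ N))) (shift n) (shift-g n) ⟩
  b n + c * g n + c * (g n + c * h n) + c * (g n + c * h n + c * h (n ℕ.+ N))
    ≡⟨ cong (λ t → b n + c * g n + c * (g n + c * h n) + c * (g n + c * h n + c * t)) (shift-h n) ⟩
  b n + c * g n + c * (g n + c * h n) + c * (g n + c * h n + c * (h n + c * l n))
    ≡⟨ collect c (b n) (g n) (h n) (l n) ⟩
  b n + + 3 * c * g n + + 3 * (c * c) * h n + c * c * c * l n ∎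
  where
  open ≡-Reasoning
  b = shifted
  g = act v shifted
  h = act (v ⊗ v) shifted
  l = act (v ⊗ (v ⊗ v)) shifted
  reindex : ∀ n N → n ℕ.+ 3 ℕ.* N ≡ n ℕ.+ N ℕ.+ N ℕ.+ N
  reindex = ℕ-Solver.solve-∀
  shift-act : ∀ u m → act u b (m ℕ.+ N) ≡ act u b m + c * act (u ⊗ v) b m
  shift-act u m = trans (act-+* u (λ k → b (k ℕ.+ N)) b c g m shift)
    (cong (λ t → act u b m + c * t) (act-⊗ u v b shifted-recurrent m))
  shift-g : ∀ m → g (m ℕ.+ N) ≡ g m + c * h m
  shift-g = shift-act v
  shift-h : ∀ m → h (m ℕ.+ N) ≡ h m + c * l m
  -- `shift-act (v ⊗ v)` would end in `(v ⊗ v) ⊗ v`. Applying v to `shift-g` gives `v ⊗ (v ⊗ v)`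
  -- directly, without associativity of `⊗`.
  shift-h m = begin
    h (m ℕ.+ N)                ≡⟨ act-⊗ v v b shifted-recurrent (m ℕ.+ N) ⟨
    act v g (m ℕ.+ N)          ≡⟨ act-+* v (λ k → g (k ℕ.+ N)) g c h m shift-g ⟩
    act v g m + c * act v h m
      ≡⟨ cong₂ (λ s t → s + c * t) (act-⊗ v v b shifted-recurrent m)
           (act-⊗ v (v ⊗ v) b shifted-recurrent m) ⟩
    h m + c * l m              ∎
  collect : ∀ c x y z w →
    x + c * y + c * (y + c * z) + c * (y + c * z + c * (z + c * w)) ≡
    x + + 3 * c * y + + 3 * (c * c) * z + c * c * c * w
  collect = solve-∀

-- Cube 1 + c v with c = 9 d. The linear term gives the new scale 3c = 27 d; the others have
-- coefficients 3c² = 27 d · 9 d and c³ = 27 d · 27 d². Both carry a further factor 9, so they are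
-- absorbed into `w′` and the residue `v₀` modulo 9 persists.
shift-period : ∀ j → ∃ λ w → ShiftBy (+ 9 * (+ 3) ^ j) (v₀ ⊕ + 9 · w) (period j)
shift-period zero = (+ 0 , + 0 , + 0) , shift-24
shift-period (suc j) with shift-period j
... | w , shift = w′ , λ n → begin
  b (n ℕ.+ period (suc j))        ≡⟨ cong (λ N → b (n ℕ.+ N)) (reindex (3 ℕ.^ j)) ⟩
  b (n ℕ.+ 3 ℕ.* period j)        ≡⟨ shift-triple {c} {v} shift n ⟩
  b n + + 3 * c * act v b n + + 3 * (c * c) * act v² b n + c * c * c * act v³ b n
    ≡⟨ cong (λ t → b n + + 3 * c * t + + 3 * (c * c) * act v² b n + c * c * c * act v³ b n)
         (act-v₀+9w w b n) ⟩
  b n + + 3 * c * (act v₀ b n + + 9 * act w b n) + + 3 * (c * c) * act v² b n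
    + c * c * c * act v³ b n
    ≡⟨ collect d (b n) (act v₀ b n) (act w b n) (act v² b n) (act v³ b n) ⟩
  b n + + 9 * (+ 3 * d) *
    (act v₀ b n + + 9 * (act w b n + d * act v² b n + + 3 * (d * d) * act v³ b n))
    ≡⟨ cong (λ t → b n + + 9 * (+ 3 * d) * (act v₀ b n + + 9 * t)) (act-w′ n) ⟨
  b n + + 9 * (+ 3 * d) * (act v₀ b n + + 9 * act w′ b n)
    ≡⟨ cong (λ t → b n + + 9 * (+ 3 * d) * t) (act-v₀+9w w′ b n) ⟨
  b n + + 9 * (+ 3 * d) * act (v₀ ⊕ + 9 · w′) b n ∎
  where
  open ≡-Reasoning
  b = shifted
  d = (+ 3) ^ j
  c = + 9 * d
  v = v₀ ⊕ + 9 · w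
  v² = v ⊗ v
  v³ = v ⊗ (v ⊗ v)
  w′ = w ⊕ d · v² ⊕ (+ 3 * (d * d)) · v³
  reindex : ∀ x → 24 ℕ.* (3 ℕ.* x) ≡ 3 ℕ.* (24 ℕ.* x)
  reindex = ℕ-Solver.solve-∀
  act-w′ : ∀ n → act w′ b n ≡ act w b n + d * act v² b n + + 3 * (d * d) * act v³ b n
  act-w′ n = trans (act-⊕ (w ⊕ d · v²) ((+ 3 * (d * d)) · v³) b n)
    (cong₂ _+_ (trans (act-⊕ w (d · v²) b n) (cong (λ t → act w b n + t) (act-· d v² b n)))
      (act-· (+ 3 * (d * d)) v³ b n))
  collect : ∀ d x y z s t →
    x + + 3 * (+ 9 * d) * (y + + 9 * z) + + 3 * (+ 9 * d * (+ 9 * d)) * s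
      + + 9 * d * (+ 9 * d) * (+ 9 * d) * t ≡
    x + + 9 * (+ 3 * d) * (y + + 9 * (z + d * s + + 3 * (d * d) * t))
  collect = solve-∀

-- First-order expansion of (1 + c v)^t, using v ≡ v₀ (mod 9) and 9 ∣ c. The error `e` is kept as a
-- bare integer sequence, since later only its integrality matters.
shift-multiple : ∀ j t → Σ (ℕ → ℤ) λ e → ∀ n →
  shifted (n ℕ.+ t ℕ.* period j) ≡
    shifted n + + 9 * (+ 3) ^ j * (+ t * act v₀ shifted n + + 9 * e n)
shift-multiple j zero = (λ _ → + 0) , λ n →
  trans (cong shifted (ℕ.+-identityʳ n)) (collect (shifted n) ((+ 3) ^ j) (act v₀ shifted n))
  where
  collect : ∀ x d y → x ≡ x + + 9 * d * (+ 0 * y + + 9 * + 0)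
  collect = solve-∀
shift-multiple j (suc t) with shift-period j | shift-multiple j t
... | w , shift | e , shift-t = e′ , λ n → begin
  b (n ℕ.+ suc t ℕ.* N)              ≡⟨ cong b (reindex n t N) ⟩
  b (n ℕ.+ t ℕ.* N ℕ.+ N)            ≡⟨ shift (n ℕ.+ t ℕ.* N) ⟩
  b (n ℕ.+ t ℕ.* N) + c * act v b (n ℕ.+ t ℕ.* N)
    ≡⟨ cong₂ (λ x y → x + c * y) (shift-t n)
         (act-+* v (λ k → b (k ℕ.+ t ℕ.* N)) b c F n shift-t) ⟩
  b n + c * (+ t * act v₀ b n + + 9 * e n) + c * (act v b n + c * act v F n)
    ≡⟨ cong (λ x → b n + c * (+ t * act v₀ b n + + 9 * e n) + c * (x + c * act v F n))
         (act-v₀+9w w b n) ⟩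
  b n + c * (+ t * act v₀ b n + + 9 * e n) + c * (act v₀ b n + + 9 * act w b n + c * act v F n)
    ≡⟨ collect d (b n) (+ t) (act v₀ b n) (e n) (act w b n) (act v F n) ⟩
  b n + c * ((+ 1 + + t) * act v₀ b n + + 9 * e′ n) ∎
  where
  open ≡-Reasoning
  b = shifted
  N = period j
  d = (+ 3) ^ j
  c = + 9 * d
  v = v₀ ⊕ + 9 · w
  F : ℕ → ℤ
  F n = + t * act v₀ b n + + 9 * e n
  e′ : ℕ → ℤ
  -- In the cross term c · c · `act v F n`, the second c = 9 d supplies the 9 in front of `e′`.
  e′ n = e n + act w b n + d * act v F n
  reindex : ∀ n t N → n ℕ.+ (N ℕ.+ t ℕ.* N) ≡ n ℕ.+ t ℕ.* N ℕ.+ N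
  reindex = ℕ-Solver.solve-∀
  collect : ∀ d x t y e z s →
    x + + 9 * d * (t * y + + 9 * e) + + 9 * d * (y + + 9 * z + + 9 * d * s) ≡
    x + + 9 * d * ((+ 1 + t) * y + + 9 * (e + z + d * s))
  collect = solve-∀

pos-^ : ∀ m n → + (m ℕ.^ n) ≡ (+ m) ^ n
pos-^ m zero    = refl
pos-^ m (suc n) = trans (ℤ.pos-* m (m ℕ.^ n)) (cong (λ x → + m * x) (pos-^ m n))

9*3^-nonZero : ∀ j → NonZero (+ 9 * (+ 3) ^ j)
9*3^-nonZero j = subst NonZero
  (trans (ℤ.pos-* 9 (3 ℕ.^ j)) (cong (λ x → + 9 * x) (pos-^ 3 j)))
  (ℕ.m*n≢0 9 (3 ℕ.^ j) {{_}} {{ℕ.m^n≢0 3 j}})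

-- Hensel lifting of the 3-adic zeros.

-- The certificate says K L ≡ 3 (mod 9) for L = act v₀ shifted z, so that 9 ∣ t L forces 3 ∣ t.
lift-zero : ∀ z K M → shifted z ≡ + 0 → K * act v₀ shifted z ≡ + 3 + + 9 * M →
  ∀ j t → + 81 * (+ 3) ^ j ∣ shifted (z ℕ.+ t ℕ.* period j) → 3 ℕ.∣ t
lift-zero z K M bz≡0 cert j t (divides q eq) with shift-multiple j t
... | e , shift-t = ∣⇒∣ᵤ {+ 3} {+ t} (*-cancelˡ-∣ (+ 3) {+ 3} {+ t} 9∣3t)
  where
  open ≡-Reasoning
  d = (+ 3) ^ j
  c = + 9 * d
  L = act v₀ shifted z
  -- As `shifted z` vanishes, the value at z + t · `period j` is c times the left side; cancelling c
  -- = 9 d from 81 d leaves 9.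
  divided : + t * L + + 9 * e z ≡ + 9 * q
  divided = ℤ.*-cancelˡ-≡ c _ _ {{9*3^-nonZero j}} (begin
    c * (+ t * L + + 9 * e z)             ≡⟨ ℤ.+-identityˡ _ ⟨
    + 0 + c * (+ t * L + + 9 * e z)       ≡⟨ cong (λ x → x + c * (+ t * L + + 9 * e z)) bz≡0 ⟨
    shifted z + c * (+ t * L + + 9 * e z) ≡⟨ shift-t z ⟨
    shifted (z ℕ.+ t ℕ.* period j)        ≡⟨ eq ⟩
    q * (+ 81 * d)                        ≡⟨ move q d ⟩
    c * (+ 9 * q)                         ∎)
    where
    move : ∀ q d → q * (+ 81 * d) ≡ + 9 * d * (+ 9 * q)
    move = solve-∀
  9∣3t : + 9 ∣ + 3 * + t
  9∣3t = divides (K * q - K * e z - M * + t) (begin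
    + 3 * + t
      ≡⟨ split (+ t) M ⟩
    + t * (+ 3 + + 9 * M) - + 9 * M * + t
      ≡⟨ cong (λ x → + t * x - + 9 * M * + t) cert ⟨
    + t * (K * L) - + 9 * M * + t
      ≡⟨ regroup (+ t) K L M (e z) ⟩
    K * (+ t * L + + 9 * e z) - + 9 * K * e z - + 9 * M * + t
      ≡⟨ cong (λ x → K * x - + 9 * K * e z - + 9 * M * + t) divided ⟩
    K * (+ 9 * q) - + 9 * K * e z - + 9 * M * + t
      ≡⟨ factor K q (e z) M (+ t) ⟩
    (K * q - K * e z - M * + t) * + 9 ∎)
    where
    split : ∀ t M → + 3 * t ≡ t * (+ 3 + + 9 * M) - + 9 * M * t
    split = solve-∀
    regroup : ∀ t K L M e →
      t * (K * L) - + 9 * M * t ≡ K * (t * L + + 9 * e) - + 9 * K * e - + 9 * M * t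
    regroup = solve-∀
    factor : ∀ K q e M t →
      K * (+ 9 * q) - + 9 * K * e - + 9 * M * t ≡ (K * q - K * e - M * t) * + 9
    factor = solve-∀

-- Indices into shifted: the zeros -8, -3, -1, 0 of the two-sided sequence.
data IsZero : ℕ → Set where
  zero₀ : IsZero 0
  zero₅ : IsZero 5
  zero₇ : IsZero 7
  zero₈ : IsZero 8

-- At the zeros 0, 5, 7, 8 the derivative L is 21, 142, 305, 447. Since 3 divides 21 and 447, no K
-- makes K L ≡ 1 (mod 9) there; the residue 3 is attainable at all four.
lift : ∀ {z} → IsZero z → ∀ j t → + 81 * (+ 3) ^ j ∣ shifted (z ℕ.+ t ℕ.* period j) → 3 ℕ.∣ t
lift zero₀ = lift-zero 0 (+ 1)  (+ 2)   refl refl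
lift zero₅ = lift-zero 5 (+ 12) (+ 189) refl refl
lift zero₇ = lift-zero 7 (+ 6)  (+ 203) refl refl
lift zero₈ = lift-zero 8 (+ 2)  (+ 99)  refl refl

ZeroMod24 : ℕ → Set
ZeroMod24 n = let z = n ℕ.% 24 in z ≡ 0 ⊎ z ≡ 5 ⊎ z ≡ 7 ⊎ z ≡ 8

zeroMod24? : ∀ n → Dec (ZeroMod24 n)
zeroMod24? n = let z = n ℕ.% 24 in z ℕ.≟ 0 ⊎-dec z ℕ.≟ 5 ⊎-dec z ℕ.≟ 7 ⊎-dec z ℕ.≟ 8

-- 72 is a period of shifted modulo 27.
zeros-mod-27 : (r : Fin 72) → + 27 ∣ iterateRec (toℕ r) (+ 0) -[1+ 1 ] (+ 1) → ZeroMod24 (toℕ r)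
zeros-mod-27 = toWitness {a? = Fin.all?
  {P = λ r → + 27 ∣ iterateRec (toℕ r) (+ 0) -[1+ 1 ] (+ 1) → ZeroMod24 (toℕ r)}
  λ r → + 27 ∣? iterateRec (toℕ r) (+ 0) -[1+ 1 ] (+ 1) →-dec zeroMod24? (toℕ r)} _

isZero : ∀ {z} → z ≡ 0 ⊎ z ≡ 5 ⊎ z ≡ 7 ⊎ z ≡ 8 → IsZero z
isZero (inj₁ refl)               = zero₀
isZero (inj₂ (inj₁ refl))        = zero₅
isZero (inj₂ (inj₂ (inj₁ refl))) = zero₇
isZero (inj₂ (inj₂ (inj₂ refl))) = zero₈

-- Induction on j: the weaker divisibility places n at z + t·24·3^j, and 27·3^(j+1) = 81·3^j lets
-- `lift` extract a 3 from t. The modulus 27·3^j is paired with 24·3^j because near the zeros 0 and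
-- 8, where 3 ∣ L, divisibility by 27 does not separate the classes modulo 72.
near-zero : ∀ j n → + 27 * (+ 3) ^ j ∣ shifted n →
  ∃ λ z → IsZero z × ∃ λ t → n ≡ z ℕ.+ t ℕ.* period j
near-zero zero n 27∣n =
  n ℕ.% 24 , isZero (subst (λ z → z ≡ 0 ⊎ z ≡ 5 ⊎ z ≡ 7 ⊎ z ≡ 8) rem24 (zeros-mod-27 r 27∣r)) ,
  n ℕ./ 24 , ℕ.m≡m%n+[m/n]*n n 24
  where
  r : Fin 72
  r = Fin.fromℕ< (ℕ.m%n<n n 72)
  r≡ : toℕ r ≡ n ℕ.% 72
  r≡ = Fin.toℕ-fromℕ< (ℕ.m%n<n n 72)
  rem24 : toℕ r ℕ.% 24 ≡ n ℕ.% 24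
  rem24 = trans (cong (ℕ._% 24) r≡) (ℕ.m∣n⇒o%n%m≡o%m 24 72 n (ℕ.divides 3 refl))
  -- For j = 1 the scale 9·3^j is 27, so moving by multiples of 72 preserves residues modulo 27.
  shift-72 : ∃ λ x → shifted n ≡ shifted (toℕ r) + + 27 * x
  shift-72 with shift-multiple 1 (n ℕ./ 72)
  ... | e , shift = + (n ℕ./ 72) * act v₀ shifted (toℕ r) + + 9 * e (toℕ r) , trans
    (cong shifted (trans (ℕ.m≡m%n+[m/n]*n n 72) (cong (ℕ._+ n ℕ./ 72 ℕ.* 72) (sym r≡))))
    (shift (toℕ r))
  27∣r : + 27 ∣ iterateRec (toℕ r) (+ 0) -[1+ 1 ] (+ 1)
  27∣r = subst (+ 27 ∣_) (recurrent-iterate shifted shifted-recurrent (toℕ r))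
    (∣m+n∣m⇒∣n (subst (+ 27 ∣_) (trans (proj₂ shift-72) (ℤ.+-comm (shifted (toℕ r)) _)) 27∣n)
      (∣m⇒∣m*n (proj₁ shift-72) (divides (+ 1) refl)))
near-zero (suc j) n (divides q eq) with near-zero j n (divides (q * + 3) (trans eq (move q ((+ 3) ^ j))))
  where
  move : ∀ q d → q * (+ 27 * (+ 3 * d)) ≡ q * + 3 * (+ 27 * d)
  move = solve-∀
... | z , isz , t , refl with lift isz j t (divides q (trans eq (move q ((+ 3) ^ j))))
  where
  move : ∀ q d → q * (+ 27 * (+ 3 * d)) ≡ q * (+ 81 * d)
  move = solve-∀
... | ℕ.divides s refl = z , isz , s , cong (z ℕ.+_) (reindex s (3 ℕ.^ j))
  where
  reindex : ∀ s x → s ℕ.* 3 ℕ.* (24 ℕ.* x) ≡ s ℕ.* (24 ℕ.* (3 ℕ.* x))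
  reindex = ℕ-Solver.solve-∀

IsZero⇒≤8 : ∀ {z} → IsZero z → z ≤ 8
IsZero⇒≤8 zero₀ = ℕ.z≤n
IsZero⇒≤8 zero₅ = ℕ.m≤m+n 5 3
IsZero⇒≤8 zero₇ = ℕ.m≤m+n 7 1
IsZero⇒≤8 zero₈ = ℕ.≤-refl

-- Every zero is at most 8, which is less than 8 + n, so t is positive and at least one full period
-- has been added.
beyond-zero : ∀ {z} → IsZero z → ∀ n t N → 1 ≤ n → 8 ℕ.+ n ≡ z ℕ.+ t ℕ.* N → N ≤ 8 ℕ.+ n
beyond-zero {z} isz n zero N 1≤n eq = contradiction 8+n≤8 (ℕ.<⇒≱ (ℕ.m<m+n 8 1≤n))
  where
  8+n≤8 : 8 ℕ.+ n ≤ 8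
  8+n≤8 = ℕ.≤-trans (ℕ.≤-reflexive (trans eq (ℕ.+-identityʳ z))) (IsZero⇒≤8 isz)
beyond-zero {z} isz n (suc t) N 1≤n eq = ℕ.≤-trans
  (ℕ.≤-trans (ℕ.m≤m+n N (t ℕ.* N)) (ℕ.m≤n+m (suc t ℕ.* N) z)) (ℕ.≤-reflexive (sym eq))

-- `shifted (8 + n)` reduces to `narayana n`, and 3^(3+j) = 27·3^j is the modulus of `near-zero`.
3^∣narayana⇒≤ : ∀ j n → 1 ≤ n → 3 ℕ.^ (3 ℕ.+ j) ℕ.∣ narayana n → period j ≤ 8 ℕ.+ n
3^∣narayana⇒≤ j n 1≤n 3^∣a =
  let z , isz , t , eq = near-zero j (8 ℕ.+ n) (subst (_∣ + narayana n) 3^≡ (∣ᵤ⇒∣ 3^∣a))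
  in beyond-zero isz n t (period j) 1≤n eq
  where
  27* : ∀ x → 3 ℕ.* (3 ℕ.* (3 ℕ.* x)) ≡ 27 ℕ.* x
  27* = ℕ-Solver.solve-∀
  3^≡ : + (3 ℕ.^ (3 ℕ.+ j)) ≡ + 27 * (+ 3) ^ j
  3^≡ = trans (cong +_ (27* (3 ℕ.^ j)))
    (trans (ℤ.pos-* 27 (3 ℕ.^ j)) (cong (λ x → + 27 * x) (pos-^ 3 j)))

-- Exponential growth of the sequence.

narayana-≤-suc : ∀ n → narayana n ≤ narayana (suc n)
narayana-≤-suc 0             = z≤n
narayana-≤-suc 1             = ℕ.≤-refl
narayana-≤-suc (suc (suc n)) = ℕ.m≤m+n (narayana (2 ℕ.+ n)) (narayana n)

narayana-mono-≤ : ∀ {m n} → m ≤ n → narayana m ≤ narayana n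
narayana-mono-≤ m≤n = go (ℕ.≤⇒≤′ m≤n)
  where
  go : ∀ {m n} → m ℕ.≤′ n → narayana m ≤ narayana n
  go (ℕ.≤′-reflexive refl) = ℕ.≤-refl
  go (ℕ.≤′-step {n} m≤n)   = ℕ.≤-trans (go m≤n) (narayana-≤-suc n)

-- By monotonicity a_{n+3} = a_{n+2} + a_n ≥ 2 a_n, so three steps at least double the value.
2^≤narayana : ∀ t → 2 ℕ.^ t ≤ narayana (1 ℕ.+ t ℕ.* 3)
2^≤narayana zero    = ℕ.≤-refl
2^≤narayana (suc t) = ℕ.≤-trans (ℕ.≤-reflexive (cong (2 ℕ.^ t ℕ.+_) (ℕ.+-identityʳ _)))
  (ℕ.+-mono-≤ (ℕ.≤-trans (2^≤narayana t) (narayana-mono-≤ (ℕ.m≤n+m (1 ℕ.+ t ℕ.* 3) 2)))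
              (2^≤narayana t))

≤⇒2^≤narayana : ∀ t n → 1 ℕ.+ t ℕ.* 3 ≤ n → 2 ℕ.^ t ≤ narayana n
≤⇒2^≤narayana t n ≤n = ℕ.≤-trans (2^≤narayana t) (narayana-mono-≤ ≤n)

-- Factorials: powers of 3 dividing them and upper bounds.

3^∣[3i]! : ∀ i → 3 ℕ.^ i ℕ.∣ (i ℕ.* 3) !
3^∣[3i]! zero    = ℕ.∣-refl
3^∣[3i]! (suc i) = ℕ.*-pres-∣ {3} {suc i ℕ.* 3} {3 ℕ.^ i} (ℕ.n∣m*n (suc i))
  (ℕ.∣n⇒∣m*n (2 ℕ.+ i ℕ.* 3) (ℕ.∣n⇒∣m*n (1 ℕ.+ i ℕ.* 3) (3^∣[3i]! i)))

n<m^n : ∀ m n → 1 < m → n < m ℕ.^ n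
n<m^n m zero    1<m = s≤s z≤n
n<m^n m (suc n) 1<m = begin
  2 ℕ.+ n                            ≤⟨ s≤s (ℕ.m≤n+m (suc n) n) ⟩
  suc n ℕ.+ suc n                    ≤⟨ ℕ.+-mono-≤ ih ih ⟩
  m ℕ.^ n ℕ.+ m ℕ.^ n                ≡⟨ cong (m ℕ.^ n ℕ.+_) (ℕ.+-identityʳ _) ⟨
  2 ℕ.* m ℕ.^ n                      ≤⟨ ℕ.*-monoˡ-≤ (m ℕ.^ n) 1<m ⟩
  m ℕ.* m ℕ.^ n                      ∎
  where
  open ℕ.≤-Reasoning
  ih = n<m^n m n 1<m

-- The three new factors are each at most 2^(3+k), so their product is at most 2^(3(3+k)) ≤ 2^(2y),
-- exactly what tripling the exponent y gains.
!-step-bound : ∀ k y → 3 ℕ.* (3 ℕ.+ k) ≤ y ℕ.+ y → 8 ℕ.* k ! < 2 ℕ.^ y →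
  8 ℕ.* (3 ℕ.+ k) ! < 2 ℕ.^ (3 ℕ.* y)
!-step-bound k y exponent bound = begin-strict
  8 ℕ.* ((3 ℕ.+ k) ℕ.* ((2 ℕ.+ k) ℕ.* ((1 ℕ.+ k) ℕ.* k !)))
    ≡⟨ regroup (3 ℕ.+ k) (2 ℕ.+ k) (1 ℕ.+ k) (k !) ⟩
  (3 ℕ.+ k) ℕ.* (2 ℕ.+ k) ℕ.* (1 ℕ.+ k) ℕ.* (8 ℕ.* k !)
    ≤⟨ ℕ.*-monoˡ-≤ (8 ℕ.* k !) factors ⟩
  2 ℕ.^ (y ℕ.+ y) ℕ.* (8 ℕ.* k !)
    <⟨ ℕ.*-monoʳ-< (2 ℕ.^ (y ℕ.+ y)) {{ℕ.m^n≢0 2 (y ℕ.+ y)}} bound ⟩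
  2 ℕ.^ (y ℕ.+ y) ℕ.* 2 ℕ.^ y
    ≡⟨ ℕ.^-distribˡ-+-* 2 (y ℕ.+ y) y ⟨
  2 ℕ.^ (y ℕ.+ y ℕ.+ y)
    ≡⟨ cong (2 ℕ.^_) (triple y) ⟩
  2 ℕ.^ (3 ℕ.* y) ∎
  where
  open ℕ.≤-Reasoning
  p = 2 ℕ.^ (3 ℕ.+ k)
  regroup : ∀ a b c f → 8 ℕ.* (a ℕ.* (b ℕ.* (c ℕ.* f))) ≡ a ℕ.* b ℕ.* c ℕ.* (8 ℕ.* f)
  regroup = ℕ-Solver.solve-∀
  triple : ∀ z → z ℕ.+ z ℕ.+ z ≡ 3 ℕ.* z
  triple = ℕ-Solver.solve-∀
  factor : ∀ {i} → i ≤ 3 ℕ.+ k → i ≤ p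
  factor i≤ = ℕ.≤-trans i≤ (ℕ.<⇒≤ (n<m^n 2 (3 ℕ.+ k) (s≤s (s≤s z≤n))))
  cube : ∀ z → z ℕ.* z ℕ.* z ≡ z ℕ.* (z ℕ.* (z ℕ.* 1))
  cube = ℕ-Solver.solve-∀
  factors : (3 ℕ.+ k) ℕ.* (2 ℕ.+ k) ℕ.* (1 ℕ.+ k) ≤ 2 ℕ.^ (y ℕ.+ y)
  factors = begin
    (3 ℕ.+ k) ℕ.* (2 ℕ.+ k) ℕ.* (1 ℕ.+ k)
      ≤⟨ ℕ.*-mono-≤ (ℕ.*-mono-≤ (factor ℕ.≤-refl) (factor (ℕ.n≤1+n (2 ℕ.+ k))))
           (factor (ℕ.m≤n+m (1 ℕ.+ k) 2)) ⟩
    p ℕ.* p ℕ.* p                 ≡⟨ cube p ⟩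
    p ℕ.^ 3                       ≡⟨ ℕ.^-*-assoc 2 (3 ℕ.+ k) 3 ⟩
    2 ℕ.^ ((3 ℕ.+ k) ℕ.* 3)       ≡⟨ cong (2 ℕ.^_) (ℕ.*-comm (3 ℕ.+ k) 3) ⟩
    2 ℕ.^ (3 ℕ.* (3 ℕ.+ k))       ≤⟨ ℕ.^-monoʳ-≤ 2 exponent ⟩
    2 ℕ.^ (y ℕ.+ y)               ∎

-- 3j + 17 is the largest m with ⌊m/3⌋ = 5 + j, so one bound serves three values of m. The factor 8
-- = 2³ pays for the later loss of 3 in the exponent.
!-bound : ∀ j → 8 ℕ.* (j ℕ.* 3 ℕ.+ 17) ! < 2 ℕ.^ (8 ℕ.* 3 ℕ.^ (2 ℕ.+ j))
!-bound zero    = toWitness {a? = 8 ℕ.* 17 ! ℕ.<? 2 ℕ.^ 72} _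
!-bound (suc j) = subst (λ e → 8 ℕ.* (3 ℕ.+ (j ℕ.* 3 ℕ.+ 17)) ! < 2 ℕ.^ e) (swap (3 ℕ.^ (2 ℕ.+ j)))
  (!-step-bound (j ℕ.* 3 ℕ.+ 17) (8 ℕ.* 3 ℕ.^ (2 ℕ.+ j)) exponent (!-bound j))
  where
  open ℕ.≤-Reasoning
  swap : ∀ z → 3 ℕ.* (8 ℕ.* z) ≡ 8 ℕ.* (3 ℕ.* z)
  swap = ℕ-Solver.solve-∀
  expand : ∀ j → 3 ℕ.* (3 ℕ.+ (j ℕ.* 3 ℕ.+ 17)) ≡ 60 ℕ.* 1 ℕ.+ 9 ℕ.* j
  expand = ℕ-Solver.solve-∀
  total : ∀ z → 60 ℕ.* z ℕ.+ 9 ℕ.* z ℕ.+ 75 ℕ.* z ≡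
    8 ℕ.* (3 ℕ.* (3 ℕ.* z)) ℕ.+ 8 ℕ.* (3 ℕ.* (3 ℕ.* z))
  total = ℕ-Solver.solve-∀
  -- The left side is 60 + 9j ≤ 69·3^j, by 1 ≤ 3^j and j ≤ 3^j, and the right side is 144·3^j; the
  -- slack is 75·3^j.
  exponent : 3 ℕ.* (3 ℕ.+ (j ℕ.* 3 ℕ.+ 17)) ≤ 8 ℕ.* 3 ℕ.^ (2 ℕ.+ j) ℕ.+ 8 ℕ.* 3 ℕ.^ (2 ℕ.+ j)
  exponent = begin
    3 ℕ.* (3 ℕ.+ (j ℕ.* 3 ℕ.+ 17))           ≡⟨ expand j ⟩
    60 ℕ.* 1 ℕ.+ 9 ℕ.* j
      ≤⟨ ℕ.+-mono-≤ (ℕ.*-monoʳ-≤ 60 (ℕ.m^n>0 3 j))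
           (ℕ.*-monoʳ-≤ 9 (ℕ.<⇒≤ (n<m^n 3 j (s≤s (s≤s z≤n))))) ⟩
    60 ℕ.* 3 ℕ.^ j ℕ.+ 9 ℕ.* 3 ℕ.^ j         ≤⟨ ℕ.m≤m+n _ (75 ℕ.* 3 ℕ.^ j) ⟩
    60 ℕ.* 3 ℕ.^ j ℕ.+ 9 ℕ.* 3 ℕ.^ j ℕ.+ 75 ℕ.* 3 ℕ.^ j   ≡⟨ total (3 ℕ.^ j) ⟩
    8 ℕ.* 3 ℕ.^ (2 ℕ.+ j) ℕ.+ 8 ℕ.* 3 ℕ.^ (2 ℕ.+ j) ∎

-- Comparing the bounds, and the remaining finite search.

!-mono-≤ : ∀ {m n} → m ≤ n → m ! ≤ n !
!-mono-≤ {n = n} m≤n = ℕ.∣⇒≤ {{n ℕ.!≢0}} (ℕ.m≤n⇒m!∣n! m≤n)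

period≤⇒!<narayana : ∀ j n → period (2 ℕ.+ j) ≤ 8 ℕ.+ n → (j ℕ.* 3 ℕ.+ 17) ! < narayana n
period≤⇒!<narayana j n period≤ = begin-strict
  (j ℕ.* 3 ℕ.+ 17) !    <⟨ ℕ.*-cancelˡ-< 8 _ _ 8!<8*2^s ⟩
  2 ℕ.^ s               ≤⟨ ≤⇒2^≤narayana s n (ℕ.+-cancelˡ-≤ 8 _ _ 9+3s≤8+n) ⟩
  narayana n            ∎
  where
  open ℕ.≤-Reasoning
  y = 8 ℕ.* 3 ℕ.^ (2 ℕ.+ j)
  -- Chosen so that 9 + 3s = 3y = `period (2 + j)`; removing 8 leaves 1 + 3s ≤ n, the index form of
  -- `2^≤narayana`.
  s = y ℕ.∸ 3
  3≤y : 3 ≤ y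
  3≤y = ℕ.≤-trans (ℕ.m≤m+n 3 5) (ℕ.*-monoʳ-≤ 8 (ℕ.m^n>0 3 (2 ℕ.+ j)))
  y≡ : 3 ℕ.+ s ≡ y
  y≡ = ℕ.m+[n∸m]≡n 3≤y
  8!<8*2^s : 8 ℕ.* (j ℕ.* 3 ℕ.+ 17) ! < 8 ℕ.* 2 ℕ.^ s
  8!<8*2^s = ℕ.<-≤-trans (!-bound j)
    (ℕ.≤-reflexive (trans (cong (2 ℕ.^_) (sym y≡)) (ℕ.^-distribˡ-+-* 2 3 s)))
  triple : ∀ z → 8 ℕ.* z ℕ.* 3 ≡ 24 ℕ.* z
  triple = ℕ-Solver.solve-∀
  9+3s≤8+n : 9 ℕ.+ s ℕ.* 3 ≤ 8 ℕ.+ n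
  9+3s≤8+n = ℕ.≤-trans
    (ℕ.≤-reflexive (trans (cong (ℕ._* 3) y≡) (triple (3 ℕ.^ (2 ℕ.+ j))))) period≤

-- The lower bound on m gives 3^(5+j) ∣ m!, which forces n to be large; the upper bound then keeps
-- m! below a_n.
narayana≢large-! : ∀ n m j → 1 ≤ n → (5 ℕ.+ j) ℕ.* 3 ≤ m → m ≤ j ℕ.* 3 ℕ.+ 17 → ¬ narayana n ≡ m !
narayana≢large-! n m j 1≤n lower upper eq = ℕ.<⇒≱
  (period≤⇒!<narayana j n (3^∣narayana⇒≤ (2 ℕ.+ j) n 1≤n 3^∣a))
  (ℕ.≤-trans (ℕ.≤-reflexive eq) (!-mono-≤ upper))
  where
  3^∣a : 3 ℕ.^ (5 ℕ.+ j) ℕ.∣ narayana n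
  3^∣a = subst (3 ℕ.^ (5 ℕ.+ j) ℕ.∣_) (sym eq) (ℕ.∣-trans (3^∣[3i]! (5 ℕ.+ j)) (ℕ.m≤n⇒m!∣n! lower))

narayana≡!⇒m<15 : ∀ n m → 1 ≤ n → narayana n ≡ m ! → m < 15
narayana≡!⇒m<15 n m 1≤n eq = ℕ.≰⇒> λ 15≤m →
  -- As 15 ≤ m, the subtraction does not truncate and ⌊m/3⌋ = 5 + j; the remainder, at most 2, gives
  -- the upper bound 3j + 17.
  let j    = m ℕ./ 3 ℕ.∸ 5
      5+j≡ = ℕ.m+[n∸m]≡n (ℕ./-monoˡ-≤ 3 15≤m)
      m≡   = trans (ℕ.m≡m%n+[m/n]*n m 3) (cong (λ i → m ℕ.% 3 ℕ.+ i ℕ.* 3) (sym 5+j≡))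
  in narayana≢large-! n m j 1≤n
       (subst ((5 ℕ.+ j) ℕ.* 3 ≤_) (sym m≡) (ℕ.m≤n+m ((5 ℕ.+ j) ℕ.* 3) (m ℕ.% 3)))
       (subst₂ _≤_ (sym m≡) (last j) (ℕ.+-monoˡ-≤ ((5 ℕ.+ j) ℕ.* 3) (ℕ.≤-pred (ℕ.m%n<n m 3))))
       eq
  where
  last : ∀ j → 2 ℕ.+ (5 ℕ.+ j) ℕ.* 3 ≡ j ℕ.* 3 ℕ.+ 17
  last = ℕ-Solver.solve-∀

-- 37 is the least t with 14! < 2^t, and 112 = 1 + 37·3 is the index where a_n is known to reach
-- 2^37.
narayana≡!⇒n<112 : ∀ n m → m < 15 → narayana n ≡ m ! → n < 112
narayana≡!⇒n<112 n m m<15 eq = ℕ.≰⇒> λ 112≤n → ℕ.<⇒≱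
  (ℕ.<-≤-trans (toWitness {a? = 14 ! ℕ.<? 2 ℕ.^ 37} _) (≤⇒2^≤narayana 37 n 112≤n))
  (ℕ.≤-trans (ℕ.≤-reflexive eq) (!-mono-≤ (ℕ.≤-pred m<15)))

Solution : ℕ → ℕ → Set
Solution n m =
  (n ≡ 1 × m ≡ 1) ⊎ (n ≡ 2 × m ≡ 1) ⊎ (n ≡ 3 × m ≡ 1) ⊎ (n ≡ 4 × m ≡ 2) ⊎ (n ≡ 7 × m ≡ 3)

solution? : ∀ n m → Dec (Solution n m)
solution? n m =
  (n ℕ.≟ 1 ×-dec m ℕ.≟ 1) ⊎-dec (n ℕ.≟ 2 ×-dec m ℕ.≟ 1) ⊎-dec (n ℕ.≟ 3 ×-dec m ℕ.≟ 1)
    ⊎-dec (n ℕ.≟ 4 ×-dec m ℕ.≟ 2) ⊎-dec (n ℕ.≟ 7 ×-dec m ℕ.≟ 3)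

-- Exhaustive evaluation. An element of `Fin 14` stands for m - 1, so m runs from 1 to 14; n = 0 is
-- harmless, as a_0 = 0 is no factorial.
small-solutions : (n : Fin 112) (m : Fin 14) →
  iterateRec (toℕ n) (+ 0) (+ 1) (+ 1) ≡ + (suc (toℕ m) !) → Solution (toℕ n) (suc (toℕ m))
small-solutions = toWitness
  {a? = Fin.all? {P = λ n → ∀ m → P n m} λ n → Fin.all? {P = P n} λ m →
    iterateRec (toℕ n) (+ 0) (+ 1) (+ 1) ℤ.≟ + (suc (toℕ m) !)
      →-dec solution? (toℕ n) (suc (toℕ m))} _
  where
  P : Fin 112 → Fin 14 → Set
  P n m = iterateRec (toℕ n) (+ 0) (+ 1) (+ 1) ≡ + (suc (toℕ m) !) → Solution (toℕ n) (suc (toℕ m))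

narayana≡!⇒solution : ∀ n m → 1 ≤ n → narayana n ≡ suc m ! → Solution n (suc m)
narayana≡!⇒solution n m 1≤n eq = subst₂ (λ k l → Solution k (suc l))
  (Fin.toℕ-fromℕ< n<112) (Fin.toℕ-fromℕ< m<14)
  (small-solutions (Fin.fromℕ< n<112) (Fin.fromℕ< m<14) eq′)
  where
  m<15 = narayana≡!⇒m<15 n (suc m) 1≤n eq
  n<112 = narayana≡!⇒n<112 n (suc m) m<15 eq
  m<14 : m < 14
  m<14 = ℕ.≤-pred m<15
  eq′ : iterateRec (toℕ (Fin.fromℕ< n<112)) (+ 0) (+ 1) (+ 1) ≡ + (suc (toℕ (Fin.fromℕ< m<14)) !)
  eq′ = trans (cong (λ k → iterateRec k (+ 0) (+ 1) (+ 1)) (Fin.toℕ-fromℕ< n<112))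
    (trans (sym (recurrent-iterate (λ k → + narayana k) (λ _ → refl) n))
      (trans (cong +_ eq) (cong (λ k → + (suc k !)) (sym (Fin.toℕ-fromℕ< m<14)))))

theorem2 : (n m : ℕ) → 1 ≤ n → 1 ≤ m →
    (narayana n ≡ m ! ⇔
    ((n ≡ 1 × m ≡ 1) ⊎ (n ≡ 2 × m ≡ 1) ⊎ (n ≡ 3 × m ≡ 1) ⊎ (n ≡ 4 × m ≡ 2) ⊎ (n ≡ 7 × m ≡ 3)))
theorem2 n (suc m) 1≤n _ = mk⇔ (narayana≡!⇒solution n m 1≤n) λ
  { (inj₁ (refl , refl))                      → refl
  ; (inj₂ (inj₁ (refl , refl)))               → refl
  ; (inj₂ (inj₂ (inj₁ (refl , refl))))        → refl
  ; (inj₂ (inj₂ (inj₂ (inj₁ (refl , refl))))) → refl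
  ; (inj₂ (inj₂ (inj₂ (inj₂ (refl , refl))))) → refl
  }
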